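{- For all integers $n\geq 0$ and $k\geq 2$ there exists a bijection $\Phi:\mathrm{BNW}_{n+1}^{(k)}\to\mathrm{NC}_{n+1}^{(k)}$ such that $P$ and $\Phi(P)$ have the same number of blocks for every $P\in\mathrm{BNW}_{n+1}^{(k)}$. In particular $\sum_{P\in\mathrm{BNW}_{n+1}^{(k)}}t^{|P|}=\sum_{P\in\mathrm{NC}_{n+1}^{(k)}}t^{|P|}$, where $|P|$ is the number of blocks.
   Context: Here partitions are partitions of $\{0,1,\dots,n\}$. The arc diagram of a partition $P$ has an arc $(i,j)$, $i<j$, whenever $i,j$ lie in the same block and that block contains no $l$ with $i<l<j$ (and a loop at $i$ if $\{i\}$ is a block). A $k$-crossing is a set of $k$ arcs $(i_1,j_1),\dots,(i_k,j_k)$ with $i_1<\cdots<i_k<j_1<\cdots<j_k$; a weak $k$-crossing is a set of $k$ arcs with $i_1<\cdots<i_k=j_1<j_2<\cdots<j_k$; together they are the enhanced $k$-crossings. The block containing $0$ is the red block; its elements and the arcs joining two of its elements are red, all other elements and arcs are black. An (enhanced) $k$-crossing is black if all its arcs are black. $\mathrm{NC}_{n+1}^{(k)}$ is the set of partitions of $\{0,\dots,n\}$ with no $k$-crossing, and $\mathrm{BNW}_{n+1}^{(k)}$ is the set of partitions of $\{0,\dots,n\}$ with no black $k$-crossing and no black weak $k$-crossing. -}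

module Defs where

open import Data.Nat using (ℕ; zero; suc; _≤_)
open import Data.Fin as F using (Fin; fromℕ) renaming (_<_ to _<F_; _≤_ to _≤F_)
open import Data.Fin.Properties using (_≟_)
open import Data.Vec using (Vec; lookup)
open import Data.List using (length; filter)
open import Data.List.Base using () renaming (allFin to allFinL)
open import Data.Product using (_×_; Σ)
open import Data.Empty using (⊥)
open import Relation.Nullary using (¬_)
open import Relation.Binary.PropositionalEquality using (_≡_)

-- A set partition of {0,…,n} = Fin (suc n) is encoded canonically by the map
-- sending each element to the least element of its block ("minimum labelling").
-- Such maps are exactly the v with v i ≤ i and v (v i) ≡ v i.
IsMinLabel : ∀ {n} → Vec (Fin (suc n)) (suc n) → Set
IsMinLabel {n} v = (∀ i → lookup v i ≤F i) × (∀ i → lookup v (lookup v i) ≡ lookup v i)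

SameBlock : ∀ {n} → Vec (Fin (suc n)) (suc n) → Fin (suc n) → Fin (suc n) → Set
SameBlock v i j = lookup v i ≡ lookup v j

-- (i , j) is an arc of the arc diagram (loops are irrelevant for k-crossings, k ≥ 1)
Arc : ∀ {n} → Vec (Fin (suc n)) (suc n) → Fin (suc n) → Fin (suc n) → Set
Arc v i j = i <F j × SameBlock v i j × (∀ l → i <F l → l <F j → ¬ SameBlock v i l)

-- an element is red iff it lies in the block of 0; an arc is black iff it is not red,
-- i.e. its endpoints (which share a block) are not in the block of 0
BlackArc : ∀ {n} → Vec (Fin (suc n)) (suc n) → Fin (suc n) → Fin (suc n) → Set
BlackArc v i j = Arc v i j × ¬ SameBlock v F.zero i

StrictInc : ∀ {k n} → (Fin k → Fin (suc n)) → Set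
StrictInc {k} a = ∀ (s t : Fin k) → s <F t → a s <F a t

CrossingOf : ∀ {n} → (Fin (suc n) → Fin (suc n) → Set) → ℕ → Set
CrossingOf A zero = ⊥
CrossingOf {n} A (suc m) =
  Σ (Fin (suc m) → Fin (suc n)) λ a → Σ (Fin (suc m) → Fin (suc n)) λ b →
    (∀ t → A (a t) (b t)) × StrictInc a × StrictInc b × (a (fromℕ m) <F b F.zero)

WeakCrossingOf : ∀ {n} → (Fin (suc n) → Fin (suc n) → Set) → ℕ → Set
WeakCrossingOf A zero = ⊥
WeakCrossingOf {n} A (suc m) =
  Σ (Fin (suc m) → Fin (suc n)) λ a → Σ (Fin (suc m) → Fin (suc n)) λ b →
    (∀ t → A (a t) (b t)) × StrictInc a × StrictInc b × (a (fromℕ m) ≡ b F.zero)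

record NC (n k : ℕ) : Set where
  constructor mkNC
  field
    labels : Vec (Fin (suc n)) (suc n)
    .isPartition : IsMinLabel labels
    .noCrossing : ¬ CrossingOf (Arc labels) k

record BNW (n k : ℕ) : Set where
  constructor mkBNW
  field
    labels : Vec (Fin (suc n)) (suc n)
    .isPartition : IsMinLabel labels
    .noBlackCrossing : ¬ CrossingOf (BlackArc labels) k
    .noBlackWeakCrossing : ¬ WeakCrossingOf (BlackArc labels) k

-- number of blocks = number of elements that are the minimum of their block
numBlocks : ∀ {n} → Vec (Fin (suc n)) (suc n) → ℕ
numBlocks {n} v = length (filter (λ i → lookup v i ≟ i) (allFinL (suc n)))

{-# OPTIONS --safe #-}
-- Send a partition P to the partition Φ P whose arcs are (i − 1 , j) for every black arc (i , j)
-- of P and (j − 1 , j) for every red j > 0.  An arc (j − 1 , j) lies in no k-crossing with k ≥ 2,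
-- and i_k − 1 < j_1 means i_k ≤ j_1, so the k-crossings of Φ P are exactly the images of the black
-- k-crossings and black weak k-crossings of P.  The inverse reads off the red elements from the
-- arcs (j − 1 , j).  An element is least in its block of P iff it is least in its block of Φ P, so
-- the number of blocks is preserved.
module Submission where

open import Defs
open import Data.Nat using (ℕ; zero; suc; _≤_; _<_; z≤n; s≤s; s<s; s≤s⁻¹; s<s⁻¹)
import Data.Nat.Properties as ℕ
open import Data.Nat.GeneralisedArithmetic using (iterate)
open import Data.Fin as F using (Fin; fromℕ; toℕ; fromℕ<) renaming (_<_ to _<F_; _≤_ to _≤F_)
open import Data.Fin.Properties as F
  using (_≟_; _≤?_; _<?_; <-cmp; any?; all?; toℕ-injective; toℕ-inject₁; toℕ-fromℕ<;
         toℕ<n; toℕ≤pred[n]; ≤fromℕ)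
open import Data.Fin.Induction using (<-wellFounded; >-wellFounded)
open import Data.List.Properties using (filter-≐)
open import Data.List.Base using (length; allFin)
open import Data.Vec using (Vec; lookup; tabulate)
open import Data.Vec.Properties using (lookup∘tabulate; tabulate∘lookup; tabulate-cong)
open import Data.Product using (Σ; ∃; _×_; _,_; proj₁; proj₂)
open import Data.Sum using (_⊎_; inj₁; inj₂; [_,_])
open import Function.Bundles using (_⤖_; Bijection; mk↔ₛ′)
open import Function.Properties.Inverse using (↔⇒⤖)
open import Induction.WellFounded using (Acc; acc)
open import Relation.Binary.Definitions using (tri<; tri≈; tri>)
open import Relation.Binary.PropositionalEquality
  using (_≡_; _≢_; refl; sym; trans; cong; subst; subst₂)
open import Relation.Nullary using (¬_; Dec; yes; no; contradiction; recompute)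
open import Relation.Nullary.Decidable using (_×-dec_; _→-dec_; ¬?)

private
  variable
    n k : ℕ

-- Labellings, predecessor and successor

Labels : ℕ → Set
Labels n = Vec (Fin (suc n)) (suc n)

≤∧≢⇒<F : {i j : Fin n} → i ≤F j → i ≢ j → i <F j
≤∧≢⇒<F i≤j i≢j = ℕ.≤∧≢⇒< i≤j λ eq → i≢j (toℕ-injective eq)

lookup-ext : {v w : Labels n} → (∀ j → lookup v j ≡ lookup w j) → v ≡ w
lookup-ext {v = v} {w} eq =
  trans (sym (tabulate∘lookup v)) (trans (tabulate-cong eq) (tabulate∘lookup w))

toℕ-pred : (i : Fin (suc n)) → i ≢ F.zero → suc (toℕ (F.pred i)) ≡ toℕ i
toℕ-pred F.zero    i≢0 = contradiction refl i≢0
toℕ-pred (F.suc i) _   = cong suc (toℕ-inject₁ i)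

pred-≤ : (i : Fin (suc n)) → F.pred i ≤F i
pred-≤ F.zero    = z≤n
pred-≤ (F.suc i) = ℕ.m≤n⇒m≤1+n (ℕ.≤-reflexive (toℕ-inject₁ i))

-- Saturates at the largest element.
next : Fin (suc n) → Fin (suc n)
next {n} i with suc (toℕ i) ℕ.<? suc n
... | yes p = fromℕ< p
... | no  _ = i

toℕ-next : {i j : Fin (suc n)} → i <F j → toℕ (next i) ≡ suc (toℕ i)
toℕ-next {n} {i} {j} i<j with suc (toℕ i) ℕ.<? suc n
... | yes p = toℕ-fromℕ< p
... | no ¬p = contradiction (ℕ.≤-<-trans i<j (toℕ<n j)) ¬p

StrictInc⇒mono : {a : Fin k → Fin (suc n)} → StrictInc a → ∀ {s t} → s ≤F t → a s ≤F a t
StrictInc⇒mono {a = a} inc {s} {t} s≤t with s ≟ t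
... | yes refl = ℕ.≤-refl
... | no s≢t   = ℕ.<⇒≤ (inc s t (≤∧≢⇒<F s≤t s≢t))

-- Arcs

isMinLabel? : (v : Labels n) → Dec (IsMinLabel v)
isMinLabel? v =
  all? (λ i → lookup v i ≤? i) ×-dec all? (λ i → lookup v (lookup v i) ≟ lookup v i)

sameBlock? : (v : Labels n) → ∀ i j → Dec (SameBlock v i j)
sameBlock? v i j = lookup v i ≟ lookup v j

arc? : (v : Labels n) → ∀ i j → Dec (Arc v i j)
arc? v i j = (i <? j) ×-dec sameBlock? v i j ×-dec
  all? (λ l → (i <? l) →-dec (l <? j) →-dec ¬? (sameBlock? v i l))

lookup-zero : (v : Labels n) → IsMinLabel v → lookup v F.zero ≡ F.zero
lookup-zero v (v≤ , _) = toℕ-injective (ℕ.n≤0⇒n≡0 (v≤ F.zero))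

arc-uniqueʳ : (v : Labels n) → ∀ {i j j′} → Arc v i j → Arc v i j′ → j ≡ j′
arc-uniqueʳ v {j = j} {j′} (i<j , s , e) (i<j′ , s′ , e′) with <-cmp j j′
... | tri≈ _ j≡j′ _ = j≡j′
... | tri< j<j′ _ _ = contradiction s (e′ j i<j j<j′)
... | tri> _ _ j′<j = contradiction s′ (e j′ i<j′ j′<j)

-- Replace `i` by a later element of its block below `j` until none is left; the last one is the
-- left end of the arc into `j`.
smaller⇒arc : (v : Labels n) → ∀ {i j} → i <F j → SameBlock v i j → ∃ λ h → Arc v h j
smaller⇒arc v {i} {j} = go (>-wellFounded i)
  where
  go : ∀ {i} → Acc F._>_ i → i <F j → SameBlock v i j → ∃ λ h → Arc v h j
  go {i} (acc rs) i<j s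
    with any? (λ l → (i <? l) ×-dec (l <? j) ×-dec sameBlock? v i l)
  ... | yes (l , i<l , l<j , s′) = go (rs i<l) l<j (trans (sym s′) s)
  ... | no none = i , i<j , s , λ l i<l l<j s′ → none (l , i<l , l<j , s′)

opaque
  -- Opaque because unfolding the search makes later `with` abstractions very slow.
  -- Junk value: the predecessor of a block minimum is itself.
  prev : Labels n → Fin (suc n) → Fin (suc n)
  prev v j with any? (λ i → arc? v i j)
  ... | yes (i , _) = i
  ... | no  _       = j

  prev-arc : (v : Labels n) → IsMinLabel v → ∀ {j} → lookup v j ≢ j → Arc v (prev v j) j
  prev-arc v (v≤ , v-idem) {j} vj≢j with any? (λ i → arc? v i j)
  ... | yes (_ , arc) = arc
  ... | no  none      = contradiction (smaller⇒arc v (≤∧≢⇒<F (v≤ j) vj≢j) (v-idem j)) none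

-- Labellings from parent functions

-- A rooted forest whose trees are the blocks and whose roots are the block minima. A parent may be
-- any earlier element of the block, not just the arc predecessor; injectivity on a block forces the
-- two to agree.
record IsParent (p : Fin (suc n) → Fin (suc n)) (v : Labels n) : Set where
  field
    parent≤ : ∀ j → p j ≤F j
    root    : ∀ {j} → p j ≡ j → lookup v j ≡ j
    step    : ∀ j → lookup v (p j) ≡ lookup v j

module _ {p : Fin (suc n) → Fin (suc n)} where

  module _ {v : Labels n} (par : IsParent p v) where
    open IsParent par

    parent<⊎≡ : ∀ j → p j <F j ⊎ p j ≡ j
    parent<⊎≡ j with p j ≟ j
    ... | yes eq = inj₂ eq
    ... | no neq = inj₁ (≤∧≢⇒<F (parent≤ j) neq)

    label≤ : ∀ j → lookup v j ≤F j
    label≤ j = go (<-wellFounded j)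
      where
      go : ∀ {j} → Acc _<F_ j → lookup v j ≤F j
      go {j} (acc rs) with parent<⊎≡ j
      ... | inj₂ eq = ℕ.≤-reflexive (cong toℕ (root eq))
      ... | inj₁ lt = subst (_≤F j) (step j) (ℕ.≤-trans (go (rs lt)) (parent≤ j))

    label-idem : ∀ j → lookup v (lookup v j) ≡ lookup v j
    label-idem j = go (<-wellFounded j)
      where
      go : ∀ {j} → Acc _<F_ j → lookup v (lookup v j) ≡ lookup v j
      go {j} (acc rs) with parent<⊎≡ j
      ... | inj₂ eq = cong (lookup v) (root eq)
      ... | inj₁ lt = subst (λ x → lookup v x ≡ x) (step j) (go (rs lt))

    isMinLabel : IsMinLabel v
    isMinLabel = label≤ , label-idem

    label-fixed⇒parent-fixed : ∀ {j} → lookup v j ≡ j → p j ≡ j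
    label-fixed⇒parent-fixed {j} eq with parent<⊎≡ j
    ... | inj₂ pj≡j = pj≡j
    ... | inj₁ pj<j =
      contradiction (subst (_≤F p j) (trans (step j) eq) (label≤ (p j))) (ℕ.<⇒≱ pj<j)

    -- Injectivity makes the tree of the block a path. It is stated per block because the parents
    -- used by `raise` are injective only away from the block of 0, where every right end of an arc
    -- (j - 1 , j) has parent 0.
    InjectiveOnBlock : Fin (suc n) → Set
    InjectiveOnBlock r = ∀ {j j′} → lookup v j ≡ r → lookup v j′ ≡ r →
                         p j <F j → p j′ <F j′ → p j ≡ p j′ → j ≡ j′

    smaller⇒parent< : ∀ {i j} → i <F j → SameBlock v i j → p j <F j
    smaller⇒parent< {i} {j} i<j s with parent<⊎≡ j
    ... | inj₁ lt = lt
    ... | inj₂ eq = contradiction (subst (_≤F i) (trans s (root eq)) (label≤ i)) (ℕ.<⇒≱ i<j)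

    module _ {r : Fin (suc n)} (inj : InjectiveOnBlock r) where

      -- Suppose p j < i < j in one block. Outer induction at `i` gives p j ≤ p i, and injectivity
      -- makes this strict. Inner induction, with p i in place of `i`, gives p i ≤ p j, a
      -- contradiction.
      smaller⇒≤parent : ∀ {i j} → i <F j → lookup v i ≡ r → lookup v j ≡ r → i ≤F p j
      smaller⇒≤parent {i} {j} = go (<-wellFounded j)
        where
        go : ∀ {j} → Acc _<F_ j →
             ∀ {i} → i <F j → lookup v i ≡ r → lookup v j ≡ r → i ≤F p j
        go {j} (acc rsj) {i} i<j vi vj = descend (<-wellFounded i) i<j vi
          where
          descend : ∀ {i} → Acc _<F_ i → i <F j → lookup v i ≡ r → i ≤F p j
          descend {i} (acc rsi) i<j vi with i ≤? p j
          ... | yes le = le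
          ... | no nle = contradiction (go (rsj i<j) pj<i vpj vi) λ pj≤pi →
            ℕ.<⇒≱ (≤∧≢⇒<F pj≤pi pj≢pi)
              (descend (rsi pi<i) (ℕ.<-trans pi<i i<j) (trans (step i) vi))
            where
            pj<i = ℕ.≰⇒> nle
            vpj  = trans (step j) vj
            pi<i = smaller⇒parent< pj<i (trans vpj (sym vi))
            pj<j = smaller⇒parent< i<j (trans vi (sym vj))

            pj≢pi : p j ≢ p i
            pj≢pi eq = F.<⇒≢ i<j (inj vi vj pi<i pj<j (sym eq))

      -- The parent of `j` lies in the block, below `j` and not below `i`, and an arc leaves no
      -- element of the block strictly between its ends.
      arc⇒parent : ∀ {i j} → Arc v i j → lookup v i ≡ r → p j ≡ i
      arc⇒parent {i} {j} (i<j , s , none) vi with p j ≟ i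
      ... | yes eq = eq
      ... | no neq = contradiction (trans s (sym (step j)))
        (none (p j) (≤∧≢⇒<F (smaller⇒≤parent i<j vi vj) λ eq → neq (sym eq))
                    (smaller⇒parent< i<j s))
        where vj = trans (sym s) vi

  -- Both inverse laws rest on this: it suffices that the original labelling admits the parent
  -- function of the composite.
  parent-unique : {v w : Labels n} → IsParent p v → IsParent p w → v ≡ w
  parent-unique {v} {w} pv pw = lookup-ext λ j → go (<-wellFounded j)
    where
    go : ∀ {j} → Acc _<F_ j → lookup v j ≡ lookup w j
    go {j} (acc rs) with parent<⊎≡ pv j
    ... | inj₂ eq = trans (IsParent.root pv eq) (sym (IsParent.root pw eq))
    ... | inj₁ lt =
      trans (sym (IsParent.step pv j)) (trans (go (rs lt)) (IsParent.step pw j))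

opaque
  -- For a weakly decreasing `p`, `n` iterations suffice: the path from an element of value at most
  -- `n` strictly decreases until it reaches its root.
  roots : (Fin (suc n) → Fin (suc n)) → Labels n
  roots {n} p = tabulate λ j → iterate p j n

  lookup-roots : (p : Fin (suc n) → Fin (suc n)) → ∀ j → lookup (roots p) j ≡ iterate p j n
  lookup-roots {n} p = lookup∘tabulate λ j → iterate p j n

module _ {p : Fin (suc n) → Fin (suc n)} (p≤ : ∀ j → p j ≤F j) where

  iterate-fixed : ∀ {j} m → p j ≡ j → iterate p j m ≡ j
  iterate-fixed zero    eq = refl
  iterate-fixed (suc m) eq = trans (cong (λ x → iterate p x m) eq) (iterate-fixed m eq)

  iterate-parent : ∀ {j} m → toℕ j ≤ m → iterate p (p j) m ≡ iterate p j m
  iterate-parent {j} m le with p j ≟ j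
  ... | yes eq = cong (λ x → iterate p x m) eq
  iterate-parent {j} zero    le | no neq =
    contradiction (ℕ.<-≤-trans (≤∧≢⇒<F (p≤ j) neq) le) λ ()
  iterate-parent {j} (suc m) le | no neq =
    iterate-parent m (s≤s⁻¹ (ℕ.≤-trans (≤∧≢⇒<F (p≤ j) neq) le))

  roots-isParent : IsParent p (roots p)
  roots-isParent = record
    { parent≤ = p≤
    ; root    = λ {j} eq → trans (lookup-roots p j) (iterate-fixed n eq)
    ; step    = λ j → trans (lookup-roots p (p j))
                     (trans (iterate-parent n (toℕ≤pred[n] j)) (sym (lookup-roots p j)))
    }

-- From BNW to NC

lowerParent : Labels n → Fin (suc n) → Fin (suc n)
lowerParent v j with lookup v j ≟ F.zero | lookup v j ≟ j
-- `F.pred` fixes 0, so the element 0 stays a root.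
... | yes _ | _     = F.pred j
... | no _  | yes _ = j
... | no _  | no _  = F.pred (prev v j)

lower : Labels n → Labels n
lower v = roots (lowerParent v)

data Lowered (v : Labels n) (j : Fin (suc n)) : Fin (suc n) → Set where
  red   : lookup v j ≡ F.zero → Lowered v j (F.pred j)
  root  : lookup v j ≢ F.zero → lookup v j ≡ j → Lowered v j j
  black : ∀ {i} → lookup v i ≢ F.zero → Arc v i j → Lowered v j (F.pred i)

label≢0⇒≢0 : (v : Labels n) → IsMinLabel v → ∀ {j} → lookup v j ≢ F.zero → j ≢ F.zero
label≢0⇒≢0 v min vj≢0 refl = vj≢0 (lookup-zero v min)

module Lower (v : Labels n) (min : IsMinLabel v) where

  lowered : ∀ j → Lowered v j (lowerParent v j)
  lowered j with lookup v j ≟ F.zero | lookup v j ≟ j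
  ... | yes vj≡0 | _        = red vj≡0
  ... | no vj≢0  | yes vj≡j = root vj≢0 vj≡j
  ... | no vj≢0  | no vj≢j  = black (λ vi≡0 → vj≢0 (trans (sym s) vi≡0)) arc
    where
    arc = prev-arc v min vj≢j
    s   = proj₁ (proj₂ arc)

  lowerParent≤ : ∀ j → lowerParent v j ≤F j
  lowerParent≤ j with lowerParent v j | lowered j
  ... | _ | red _                 = pred-≤ j
  ... | _ | root _ _              = ℕ.≤-refl
  ... | _ | black {i} _ (i<j , _) = ℕ.≤-trans (pred-≤ i) (ℕ.<⇒≤ i<j)

  lower-isParent : IsParent (lowerParent v) (lower v)
  lower-isParent = roots-isParent lowerParent≤

  -- Undoes the shift. A red `j` counts as its own source, so in both cases the parent is one less
  -- than the source.
  lowered-source : ∀ j → lowerParent v j <F j → ∃ λ i →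
    toℕ i ≡ suc (toℕ (lowerParent v j)) × (lookup v j ≡ F.zero × i ≡ j ⊎ BlackArc v i j)
  lowered-source j lt with lowerParent v j | lowered j
  ... | _ | red vj≡0        =
    j , sym (toℕ-pred j λ { refl → contradiction lt λ () }) , inj₁ (vj≡0 , refl)
  ... | _ | root _ _        = contradiction lt (ℕ.<-irrefl refl)
  ... | _ | black {i} vi≢0 arc =
    i , sym (toℕ-pred i (label≢0⇒≢0 v min vi≢0)) ,
    inj₂ (arc , λ eq → vi≢0 (trans (sym eq) (lookup-zero v min)))

  blackArc⇒label≢0 : ∀ {i j} → BlackArc v i j → lookup v j ≢ F.zero
  blackArc⇒label≢0 ((_ , s , _) , b) vj≡0 = b (trans (lookup-zero v min) (sym (trans s vj≡0)))

  lowerParent-injective : ∀ {j j′} → lowerParent v j <F j → lowerParent v j′ <F j′ →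
                          lowerParent v j ≡ lowerParent v j′ → j ≡ j′
  lowerParent-injective {j} {j′} lt lt′ eq
    with i , ei , c ← lowered-source j lt | i′ , ei′ , c′ ← lowered-source j′ lt′
    with refl ← toℕ-injective {i = i} {i′} (trans ei (trans (cong (λ x → suc (toℕ x)) eq) (sym ei′)))
    with c | c′
  ... | inj₁ (_ , refl) | inj₁ (_ , refl) = refl
  ... | inj₁ (r , refl) | inj₂ b@((_ , s , _) , _) =
    contradiction (trans (sym s) r) (blackArc⇒label≢0 b)
  ... | inj₂ b@((_ , s , _) , _) | inj₁ (r , refl) =
    contradiction (trans (sym s) r) (blackArc⇒label≢0 b)
  ... | inj₂ (arc , _) | inj₂ (arc′ , _) = arc-uniqueʳ v arc arc′

  arc-lower : ∀ {h j} → Arc (lower v) h j → ∃ λ i →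
    toℕ i ≡ suc (toℕ h) × (lookup v j ≡ F.zero × i ≡ j ⊎ BlackArc v i j)
  arc-lower {h} {j} arc
    with refl ← arc⇒parent lower-isParent (λ _ _ → lowerParent-injective) arc refl
    = lowered-source j (proj₁ arc)

  -- The roots agree: a red element is fixed by `F.pred` only if it is 0, and the right end of a
  -- black arc gets a strictly smaller parent.
  lower-fixed⇔ : ∀ {j} → (lookup (lower v) j ≡ j → lookup v j ≡ j) ×
                         (lookup v j ≡ j → lookup (lower v) j ≡ j)
  lower-fixed⇔ {j} = to , λ eq → IsParent.root lower-isParent (from eq)
    where
    to : lookup (lower v) j ≡ j → lookup v j ≡ j
    to eq with lowerParent v j | lowered j | label-fixed⇒parent-fixed lower-isParent {j} eq
    ... | _ | root _ vj≡j | _ = vj≡j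
    ... | _ | black {i} _ (i<j , _) | pi≡j =
      contradiction (subst (_≤F i) pi≡j (pred-≤ i)) (ℕ.<⇒≱ i<j)
    ... | _ | red vj≡0 | pj≡j with j ≟ F.zero
    ...   | yes refl = lookup-zero v min
    ...   | no j≢0 = contradiction (trans (toℕ-pred j j≢0) (cong toℕ (sym pj≡j))) ℕ.1+n≢n

    from : lookup v j ≡ j → lowerParent v j ≡ j
    from eq with lowerParent v j | lowered j
    ... | _ | red vj≡0 with refl ← trans (sym eq) vj≡0 = refl
    ... | _ | root _ _ = refl
    ... | _ | black {i} _ (i<j , s , _) =
      contradiction (subst (_≤F i) (trans s eq) (proj₁ min i)) (ℕ.<⇒≱ i<j)

  numBlocks-lower : numBlocks (lower v) ≡ numBlocks v
  numBlocks-lower = cong length (filter-≐ (λ j → lookup (lower v) j ≟ j) (λ j → lookup v j ≟ j)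
    (proj₁ lower-fixed⇔ , proj₂ lower-fixed⇔) (allFin _))

  lower-crossing : CrossingOf (Arc (lower v)) (suc (suc k)) →
    CrossingOf (BlackArc v) (suc (suc k)) ⊎ WeakCrossingOf (BlackArc v) (suc (suc k))
  lower-crossing {k} (a , b , arcs , a-inc , b-inc , a<b) = split (ℕ.m≤n⇒m<n∨m≡n i≤b)
    where
    last = fromℕ (suc k)

    a≤last : ∀ t → a t ≤F a last
    a≤last t = StrictInc⇒mono a-inc (≤fromℕ t)

    -- This is where k ≥ 2 enters: t cannot be both the first and the last index.
    long : ∀ t → suc (toℕ (a t)) < toℕ (b t)
    long F.zero    = ℕ.≤-<-trans (a-inc F.zero last (s≤s z≤n)) a<b
    long (F.suc t) = ℕ.≤-<-trans (ℕ.≤-<-trans (a≤last (F.suc t)) a<b)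
                                 (b-inc F.zero (F.suc t) (s≤s z≤n))

    source : ∀ t → ∃ λ i → toℕ i ≡ suc (toℕ (a t)) × BlackArc v i (b t)
    source t with arc-lower (arcs t)
    -- A red right end would give an arc (j - 1 , j), which `long` excludes.
    ... | i , ei , inj₁ (_ , refl) = contradiction (long t) (ℕ.<-irrefl (sym ei))
    ... | i , ei , inj₂ bl         = i , ei , bl

    i : Fin (suc (suc k)) → Fin (suc n)
    i t = proj₁ (source t)

    ei : ∀ t → toℕ (i t) ≡ suc (toℕ (a t))
    ei t = proj₁ (proj₂ (source t))

    blacks : ∀ t → BlackArc v (i t) (b t)
    blacks t = proj₂ (proj₂ (source t))

    i-inc : StrictInc i
    i-inc s t s<t = subst₂ _<_ (sym (ei s)) (sym (ei t)) (s<s (a-inc s t s<t))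

    i≤b : i last ≤F b F.zero
    i≤b = subst (_≤ toℕ (b F.zero)) (sym (ei last)) a<b

    split : toℕ (i last) < toℕ (b F.zero) ⊎ toℕ (i last) ≡ toℕ (b F.zero) →
      CrossingOf (BlackArc v) (suc (suc k)) ⊎ WeakCrossingOf (BlackArc v) (suc (suc k))
    split (inj₁ lt) = inj₁ (i , b , blacks , i-inc , b-inc , lt)
    split (inj₂ eq) = inj₂ (i , b , blacks , i-inc , b-inc , toℕ-injective eq)

  lower-noncrossing : ¬ CrossingOf (BlackArc v) (suc (suc k)) →
    ¬ WeakCrossingOf (BlackArc v) (suc (suc k)) → ¬ CrossingOf (Arc (lower v)) (suc (suc k))
  lower-noncrossing noB noW c = [ noB , noW ] (lower-crossing c)

-- From NC to BNW

-- The parent of a red element is 0 rather than the preceding red element: only the red block as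
-- a whole matters, not its arcs.
raiseParent : Labels n → Fin (suc n) → Fin (suc n)
raiseParent w j with lookup w j ≟ j | next (prev w j) ≟ j
... | yes _ | _     = j
... | no _  | yes _ = F.zero
... | no _  | no _  = next (prev w j)

raise : Labels n → Labels n
raise w = roots (raiseParent w)

data Raised (w : Labels n) (j : Fin (suc n)) : Fin (suc n) → Set where
  root  : lookup w j ≡ j → Raised w j j
  short : ∀ {i} → Arc w i j → toℕ j ≡ suc (toℕ i) → Raised w j F.zero
  long  : ∀ {i x} → Arc w i j → toℕ x ≡ suc (toℕ i) → x <F j → Raised w j x

module Raise (w : Labels n) (min : IsMinLabel w) where

  raised : ∀ j → Raised w j (raiseParent w j)
  -- The second test asks whether the arc ending in `j` is (j - 1 , j), the mark of a red element.
  raised j with lookup w j ≟ j | next (prev w j) ≟ j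
  ... | yes wj≡j | _      = root wj≡j
  ... | no wj≢j  | yes eq = short arc (trans (cong toℕ (sym eq)) (toℕ-next (proj₁ arc)))
    where arc = prev-arc w min wj≢j
  ... | no wj≢j  | no neq = long arc en
    (≤∧≢⇒<F (subst (_≤ toℕ j) (sym en) (proj₁ arc)) neq)
    where
    arc = prev-arc w min wj≢j
    en  = toℕ-next (proj₁ arc)

  raiseParent≤ : ∀ j → raiseParent w j ≤F j
  raiseParent≤ j with raiseParent w j | raised j
  ... | _ | root _       = ℕ.≤-refl
  ... | _ | short _ _    = z≤n
  ... | _ | long _ _ x<j = ℕ.<⇒≤ x<j

  raiseParent-fixed : ∀ {j} → raiseParent w j ≡ j → lookup w j ≡ j
  raiseParent-fixed {j} eq with raiseParent w j | raised j
  ... | _ | root wj≡j = wj≡j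
  ... | _ | short _ _ with refl ← eq = lookup-zero w min
  ... | _ | long _ _ x<j with refl ← eq = contradiction x<j (ℕ.<-irrefl refl)

  raise-isParent : IsParent (raiseParent w) (raise w)
  raise-isParent = roots-isParent raiseParent≤

  raise-isMinLabel : IsMinLabel (raise w)
  raise-isMinLabel = isMinLabel raise-isParent

  -- Suppose a red `j` ends a longer arc (i , j). Its parent i + 1 is then red and nonzero, so by
  -- induction it ends the arc (i , i + 1). But `i` is the left end of only one arc.
  raise-red⇒short : ∀ {j} → lookup (raise w) j ≡ F.zero → j ≢ F.zero →
                    ∃ λ i → Arc w i j × toℕ j ≡ suc (toℕ i)
  raise-red⇒short {j} = go (<-wellFounded j)
    where
    go : ∀ {j} → Acc _<F_ j → lookup (raise w) j ≡ F.zero → j ≢ F.zero →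
         ∃ λ i → Arc w i j × toℕ j ≡ suc (toℕ i)
    go {j} (acc rs) vj≡0 j≢0 with raiseParent w j in eq | raised j | IsParent.step raise-isParent j
    ... | _ | root _ | _ = contradiction (trans (sym (IsParent.root raise-isParent eq)) vj≡0) j≢0
    ... | _ | short arc e | _ = _ , arc , e
    ... | x | long {i} arc e x<j | st
      with h , arc′ , e′ ← go (rs x<j) (trans st vj≡0) (λ { refl → contradiction e λ () })
      with refl ← toℕ-injective {i = h} {i} (ℕ.suc-injective (trans (sym e′) e))
      = contradiction (arc-uniqueʳ w arc′ arc) (F.<⇒≢ x<j)

  -- Away from the block of 0 every non-root ends a longer arc, whose left end is one less than the
  -- parent. Equal parents thus give arcs with the same left end, hence the same right end.
  raiseParent-injective : ∀ {r} → r ≢ F.zero → InjectiveOnBlock raise-isParent r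
  raiseParent-injective r≢0 {j} {j′} vj vj′ lt lt′ eq
    with raiseParent w j | raised j | IsParent.step raise-isParent j
       | raiseParent w j′ | raised j′ | IsParent.step raise-isParent j′
  ... | _ | root _ | _ | _ | _ | _ = contradiction lt (ℕ.<-irrefl refl)
  ... | _ | _ | _ | _ | root _ | _ = contradiction lt′ (ℕ.<-irrefl refl)
  ... | _ | short _ _ | st | _ | _ | _ =
    contradiction (trans (sym vj) (trans (sym st) (lookup-zero (raise w) raise-isMinLabel))) r≢0
  ... | _ | _ | _ | _ | short _ _ | st =
    contradiction (trans (sym vj′) (trans (sym st) (lookup-zero (raise w) raise-isMinLabel))) r≢0
  ... | _ | long {i} arc e _ | _ | _ | long {i′} arc′ e′ _ | _
    with refl ← eq
    with refl ← toℕ-injective {i = i} {i′} (ℕ.suc-injective (trans (sym e) e′))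
    = arc-uniqueʳ w arc arc′

  blackArc-raise : ∀ {i j} → BlackArc (raise w) i j → ∃ λ h → Arc w h j × toℕ i ≡ suc (toℕ h)
  blackArc-raise {i} {j} (arc@(i<j , _) , b)
    with raiseParent w j | raised j
       | arc⇒parent raise-isParent (raiseParent-injective vi≢0) arc refl
    where
    vi≢0 : lookup (raise w) i ≢ F.zero
    vi≢0 eq = b (trans (lookup-zero (raise w) raise-isMinLabel) (sym eq))
  ... | _ | root _ | refl = contradiction i<j (ℕ.<-irrefl refl)
  ... | _ | short _ _ | refl = contradiction refl b
  ... | _ | long arc′ e _ | refl = _ , arc′ , e

  -- The weak inequality between `a (fromℕ k)` and `b F.zero` covers black crossings and black weak
  -- crossings at once; lowering every left end by one makes it strict.
  raise-crossing : ∀ (a b : Fin (suc k) → Fin (suc n)) → (∀ t → BlackArc (raise w) (a t) (b t)) →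
    StrictInc a → StrictInc b → a (fromℕ k) ≤F b F.zero → CrossingOf (Arc w) (suc k)
  raise-crossing {k} a b blacks a-inc b-inc a≤b =
    h , b , (λ t → proj₁ (proj₂ (source t))) , h-inc , b-inc ,
    subst (_≤ toℕ (b F.zero)) (eh (fromℕ k)) a≤b
    where
    source : ∀ t → ∃ λ h → Arc w h (b t) × toℕ (a t) ≡ suc (toℕ h)
    source t = blackArc-raise (blacks t)

    h : Fin (suc k) → Fin (suc n)
    h t = proj₁ (source t)

    eh : ∀ t → toℕ (a t) ≡ suc (toℕ (h t))
    eh t = proj₂ (proj₂ (source t))

    h-inc : StrictInc h
    h-inc s t s<t = s<s⁻¹ (subst₂ _<_ (eh s) (eh t) (a-inc s t s<t))

  private module L = Lower (raise w) raise-isMinLabel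

  lower-raise : lower (raise w) ≡ w
  lower-raise = parent-unique L.lower-isParent record
    { parent≤ = L.lowerParent≤ ; root = fixed ; step = same }
    where
    fixed : ∀ {j} → lowerParent (raise w) j ≡ j → lookup w j ≡ j
    fixed eq = raiseParent-fixed (label-fixed⇒parent-fixed raise-isParent
      (proj₁ L.lower-fixed⇔ (IsParent.root L.lower-isParent eq)))

    same : ∀ j → lookup w (lowerParent (raise w) j) ≡ lookup w j
    same j with L.lowerParent≤ j
    ... | le with lowerParent (raise w) j ≟ j
    ... | yes eq = cong (lookup w) eq
    ... | no neq with L.lowered-source j (≤∧≢⇒<F le neq)
    -- A red `j` has parent j - 1, the left end of the arc of `w` into `j`. For a black arc the two
    -- shifts cancel.
    ... | i , ei , inj₁ (vj≡0 , refl)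
      with h , (_ , s , _) , e ← raise-red⇒short vj≡0 (λ { refl → contradiction ei λ () })
      = trans (cong (lookup w) (toℕ-injective (ℕ.suc-injective (trans (sym ei) e)))) s
    ... | i , ei , inj₂ b with h , (_ , s , _) , e ← blackArc-raise b
      = trans (cong (lookup w) (toℕ-injective (ℕ.suc-injective (trans (sym ei) e)))) s

raise-lower : (v : Labels n) → IsMinLabel v → raise (lower v) ≡ v
raise-lower v min = parent-unique R.raise-isParent record
  { parent≤ = R.raiseParent≤ ; root = fixed ; step = same }
  where
  module L = Lower v min
  module R = Raise (lower v) (isMinLabel L.lower-isParent)

  same : ∀ j → lookup v (raiseParent (lower v) j) ≡ lookup v j
  same j with raiseParent (lower v) j | R.raised j
  ... | _ | root _ = refl
  ... | _ | short arc e with L.arc-lower arc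
  ...   | i , ei , inj₁ (vj≡0 , _) = trans (lookup-zero v min) (sym vj≡0)
  -- A black arc (i , j) has i < j, so its image (i - 1 , j) is never of the form (j - 1 , j). This
  -- is why the red elements can be read off.
  ...   | i , ei , inj₂ ((i<j , _) , _) = contradiction i<j (ℕ.<-irrefl (trans ei (sym e)))
  same j | x | long arc e x<j with L.arc-lower arc
  ...   | i , ei , inj₁ (_ , refl) = contradiction x<j (ℕ.<-irrefl (trans e (sym ei)))
  ...   | i , ei , inj₂ ((_ , s , _) , _) =
    trans (cong (lookup v) (toℕ-injective (trans e (sym ei)))) s

  fixed : ∀ {j} → raiseParent (lower v) j ≡ j → lookup v j ≡ j
  fixed eq = proj₁ L.lower-fixed⇔ (R.raiseParent-fixed eq)

-- The bijection between `BNW` and `NC`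

toNC : BNW n (suc (suc k)) → NC n (suc (suc k))
toNC (mkBNW v min noB noW) =
  mkNC (lower v) (isMinLabel L.lower-isParent) (L.lower-noncrossing noB noW)
  -- The field `isPartition` is irrelevant; decidability of `IsMinLabel` yields a proof usable in
  -- computations.
  where module L = Lower v (recompute (isMinLabel? v) min)

fromNC : NC n (suc (suc k)) → BNW n (suc (suc k))
fromNC (mkNC w min noC) = mkBNW (raise w) R.raise-isMinLabel
  (λ (a , b , arcs , a-inc , b-inc , lt) →
    noC (R.raise-crossing a b arcs a-inc b-inc (ℕ.<⇒≤ lt)))
  (λ (a , b , arcs , a-inc , b-inc , eq) →
    noC (R.raise-crossing a b arcs a-inc b-inc (ℕ.≤-reflexive (cong toℕ eq))))
  where module R = Raise w (recompute (isMinLabel? w) min)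

NC-≡ : {P Q : NC n k} → NC.labels P ≡ NC.labels Q → P ≡ Q
NC-≡ refl = refl

BNW-≡ : {P Q : BNW n k} → BNW.labels P ≡ BNW.labels Q → P ≡ Q
BNW-≡ refl = refl

theorem3p1 : (n k : ℕ) → 2 ≤ k →
    Σ (BNW n k ⤖ NC n k) λ Φ →
    (P : BNW n k) → numBlocks (NC.labels (Bijection.to Φ P)) ≡ numBlocks (BNW.labels P)
theorem3p1 n (suc (suc k)) _ =
  ↔⇒⤖ (mk↔ₛ′ toNC fromNC
    (λ (mkNC w min _) → NC-≡ (Raise.lower-raise w (recompute (isMinLabel? w) min)))
    (λ (mkBNW v min _ _) → BNW-≡ (raise-lower v (recompute (isMinLabel? v) min)))) ,
  λ (mkBNW v min _ _) → Lower.numBlocks-lower v (recompute (isMinLabel? v) min)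
theorem3p1 n (suc zero) (s≤s ())
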